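{- Let $G=(V,E)$ be an unweighted, undirected, simple graph with $m=|E|$ edges. The algorithm PATH-CORE (specified in the context), run on $G$, finishes in $\mathcal{O}(m^2)$ time.
   Context: Algorithm PATH-CORE. Input: $G$. Output: $C_P$ (a value for each vertex). $G\setminus(s,t)$ is the graph obtained from $G$ by removing the edge $(s,t)$, and $\Gamma_{G'}(w)$ is the set of neighbours of $w$ in the graph $G'$. Set $C_P(w)\leftarrow 0$ for all $w \in V$. For each edge $(s,t)\in E$, do the following. (0) Set $G' \leftarrow G\setminus (s,t)$; set $\sigma_s(w),\sigma_t(w)\leftarrow 0$ for all $w\in V$; set $\sigma_s(s),\sigma_t(t)\leftarrow 1$; set $d_s(w), d_t(w) \leftarrow -1$ for all $w\in V$; set $d_s(s),d_t(t)\leftarrow 0$; let $Q$ be an empty queue. (1) First search. Enqueue $s$ in $Q$. While $Q$ is not empty: dequeue $w$ from $Q$; for each $u\in\Gamma_{G'}(w)$: if $d_s(u)<0$, then enqueue $u$ and set $d_s(u)\leftarrow d_s(w)+1$. (2) Second search. Enqueue $t$ in $Q$. While $Q$ is not empty: dequeue $w$ from $Q$; for each $u\in\Gamma_{G'}(w)$: (i) if $d_t(u)<0$, then enqueue $u$ and set $d_t(u)\leftarrow d_t(w)+1$; (ii) if $d_s(u)<d_s(w)$, then set $\sigma_t(u)\leftarrow\sigma_t(u)+\sigma_t(w)$. (3) Third search. Enqueue $s$ in $Q$. While $Q$ is not empty: dequeue $w$ from $Q$; for each $u\in\Gamma_{G'}(w)$: if $d_t(u)<d_t(w)$, then enqueue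 $u$ and set $\sigma_s(u)\leftarrow\sigma_s(u)+\sigma_s(w)$. (4) For each $w\in V\setminus\{s,t\}$: set $C_P(w)\leftarrow C_P(w)+\sigma_s(w)\cdot\sigma_t(w)/\sigma_s(t)$. After all edges have been processed, output $C_P$.
   Formalization: The bound is proved for graphs with |V| ≤ K·m, the constant depending on K (isolated vertices otherwise break O(m²)), and with Q holding each vertex at most once (as literally written, the third search can be exponential); 0/0 is read as 0. -}

module Defs where

open import Data.Bool using (Bool; true; false; if_then_else_; _∨_)
open import Data.Fin using (Fin)
open import Data.Fin.Properties using (_≟_)
open import Data.Integer as ℤ using (ℤ; +_; 0ℤ; 1ℤ; -1ℤ)
open import Data.List using (List; []; _∷_; _∷ʳ_; length; allFin)
open import Data.List.Membership.Propositional using (_∈_)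
open import Data.List.Relation.Unary.All using (All)
open import Data.List.Relation.Unary.AllPairs using (AllPairs)
open import Data.List.Relation.Unary.Unique.Propositional using (Unique)
open import Data.Maybe using (Maybe; just; nothing)
open import Data.Nat using (ℕ; zero; suc; _+_; _*_; _≤_)
open import Data.Product using (_×_; _,_; ∃-syntax; swap)
open import Data.Rational as ℚ using (ℚ; 0ℚ)
open import Data.Sum using (_⊎_)
open import Data.Vec using (Vec; lookup; replicate; _[_]≔_)
open import Function using (_⇔_)
open import Relation.Binary.PropositionalEquality using (_≡_; _≢_; refl)
open import Relation.Nullary using (does)

-- Each undirected edge {u , v} is listed once, as (u , v) or as (v , u).
record Graph : Set where
  field
    n        : ℕ
    E        : List (Fin n × Fin n)
    loopless : All (λ (u , v) → u ≢ v) E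
    simple   : AllPairs (λ e f → e ≢ f × e ≢ swap f) E

  V : Set
  V = Fin n

  m : ℕ
  m = length E

  Adjacent : V → V → Set
  Adjacent u v = (u , v) ∈ E ⊎ (v , u) ∈ E

-- The input encoding; neighbours may be listed in any order.
record AdjacencyLists (G : Graph) : Set where
  open Graph G
  field
    Γ        : Vec (List V) n
    unique   : ∀ v → Unique (lookup Γ v)
    adjacent : ∀ u v → u ∈ lookup Γ v ⇔ Adjacent v u

-- A computation that may diverge, given by its cost semantics:
-- c ⇓ a after k  says that c halts with result a after k elementary steps.
record Timed (A : Set) : Set₁ where
  field
    _⇓_after_     : A → ℕ → Set
    deterministic : ∀ {a b j k} → _⇓_after_ a j → _⇓_after_ b k → a ≡ b × j ≡ k

open Timed public using () renaming (_⇓_after_ to infix 4 _⇓_after_)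

_finishesWithin_ : {A : Set} → Timed A → ℕ → Set
c finishesWithin b = ∃[ a ] ∃[ k ] (c ⇓ a after k) × k ≤ b

infix 4 _finishesWithin_

module _ {A : Set} where

  charge : ℕ → A → Timed A
  charge c a = record
    { _⇓_after_     = λ b k → b ≡ a × k ≡ c
    ; deterministic = λ where (refl , refl) (refl , refl) → refl , refl
    }

  return : A → Timed A
  return = charge 0

  op : A → Timed A
  op = charge 1

module _ {A B : Set} where

  data Bind (c : Timed A) (f : A → Timed B) : B → ℕ → Set where
    bind : ∀ {a b j k} → c ⇓ a after j → f a ⇓ b after k → Bind c f b (j + k)

  infixl 1 _>>=_

  _>>=_ : Timed A → (A → Timed B) → Timed B
  c >>= f = record { _⇓_after_ = Bind c f ; deterministic = det }
    where
    det : ∀ {a b j k} → Bind c f a j → Bind c f b k → a ≡ b × j ≡ k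
    det (bind p q) (bind p′ q′) with Timed.deterministic c p p′
    ... | refl , refl with Timed.deterministic (f _) q q′
    ... | refl , refl = refl , refl

module _ {S B : Set} where

  data While (next : S → Timed (Maybe B)) (body : B → Timed S) : S → S → ℕ → Set where
    exit : ∀ {s i} → next s ⇓ nothing after i → While next body s s i
    loop : ∀ {s b s′ s″ i j k} → next s ⇓ just b after i → body b ⇓ s′ after j →
           While next body s′ s″ k → While next body s s″ (i + j + k)

  -- Runs body on b as long as next yields just b, and stops at the first nothing.
  while : (S → Timed (Maybe B)) → (B → Timed S) → S → Timed S
  while next body s = record { _⇓_after_ = While next body s ; deterministic = det }
    where
    det : ∀ {s a b j k} → While next body s a j → While next body s b k → a ≡ b × j ≡ k
    det (exit p) (exit p′) with Timed.deterministic (next _) p p′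
    ... | refl , refl = refl , refl
    det (exit p) (loop p′ _ _) with Timed.deterministic (next _) p p′
    ... | () , _
    det (loop p _ _) (exit p′) with Timed.deterministic (next _) p p′
    ... | () , _
    det (loop p q r) (loop p′ q′ r′) with Timed.deterministic (next _) p p′
    ... | refl , refl with Timed.deterministic (body _) q q′
    ... | refl , refl with det r r′
    ... | refl , refl = refl , refl

forEach : {A S : Set} → List A → (A → S → Timed S) → S → Timed S
forEach []       f s = op s
forEach (x ∷ xs) f s = do
  s ← op s
  s ← f x s
  forEach xs f s

new : {A : Set} (n : ℕ) → A → Timed (Vec A n)
new n a = charge n (replicate n a)

read : ∀ {A : Set} {n} → Vec A n → Fin n → Timed A
read xs i = op (lookup xs i)

write : ∀ {A : Set} {n} → Vec A n → Fin n → A → Timed (Vec A n)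
write xs i a = op (xs [ i ]≔ a)

-- A FIFO queue of vertices in which a vertex occurs at most once: enqueueing a
-- vertex that is still waiting has no effect.  This only matters in the third
-- search, which tests no "visited" mark: with repeated entries it would handle a
-- vertex once per shortest path from s, hence exponentially often in general.
-- The flags in waiting decide membership in constant time.
record Queue (n : ℕ) : Set where
  constructor queue
  field
    items   : List (Fin n)
    waiting : Vec Bool n

emptyQueue : ∀ n → Timed (Queue n)
emptyQueue n = do
  waiting ← new n false
  return (queue [] waiting)

enqueue : ∀ {n} → Fin n → Queue n → Timed (Queue n)
enqueue u (queue items waiting) = do
  b ← read waiting u
  if b then return (queue items waiting) else do
    waiting ← write waiting u true
    op (queue (items ∷ʳ u) waiting)

dequeue : ∀ {n} {X : Set} → Queue n × X → Timed (Maybe (Fin n × Queue n × X))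
dequeue (queue []          waiting , x) = op nothing
dequeue (queue (w ∷ items) waiting , x) = do
  waiting ← write waiting w false
  op (just (w , queue items waiting , x))

delete : ∀ {n} → Fin n → List (Fin n) → Timed (List (Fin n))
delete v []       = op []
delete v (u ∷ us) = do
  b   ← op (does (u ≟ v))
  us′ ← delete v us
  if b then return us′ else op (u ∷ us′)

-- The quotient is totalized by a ÷ 0 = 0.  The divisor σₛ(t) is 0 exactly when
-- (s , t) is a bridge, and then so is every dividend.
_÷_ : ℕ → ℕ → ℚ
a ÷ zero  = 0ℚ
a ÷ suc b = (+ a) ℚ./ suc b

module _ {n : ℕ} where

  private
    V = Fin n
    Lists = Vec (List V) n

  infixl 6 _∖_

  -- Copies the array of lists (not the lists) and shortens the two lists concerned.
  _∖_ : Lists → V × V → Timed Lists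
  Γ ∖ (s , t) = do
    Γ′ ← charge n Γ
    us ← read Γ′ s
    us ← delete t us
    Γ′ ← write Γ′ s us
    us ← read Γ′ t
    us ← delete s us
    write Γ′ t us

  -- X holds the arrays updated by the search; visit w u handles a neighbour u of
  -- the dequeued vertex w.
  search : {X : Set} → Lists → (V → V → Queue n × X → Timed (Queue n × X)) →
           V → Queue n × X → Timed (Queue n × X)
  search Γ visit r (Q , x) = do
    Q ← enqueue r Q
    while dequeue (λ (w , Q , x) → do
      us ← read Γ w
      forEach us (visit w) (Q , x)) (Q , x)

  discover : V → V → Queue n × Vec ℤ n → Timed (Queue n × Vec ℤ n)
  discover w u (Q , d) = do
    dᵤ ← read d u
    b  ← op (does (dᵤ ℤ.<? 0ℤ))
    if b then (do
      Q  ← enqueue u Q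
      d₀ ← read d w
      d₁ ← op (d₀ ℤ.+ 1ℤ)
      d  ← write d u d₁
      return (Q , d))
     else return (Q , d)

  closer : Vec ℤ n → V → V → Timed Bool
  closer d u w = do
    dᵤ ← read d u
    d₀ ← read d w
    op (does (dᵤ ℤ.<? d₀))

  accumulate : V → V → Vec ℕ n → Timed (Vec ℕ n)
  accumulate w u σ = do
    a ← read σ u
    b ← read σ w
    c ← op (a + b)
    write σ u c

  visit₁ : V → V → Queue n × Vec ℤ n → Timed (Queue n × Vec ℤ n)
  visit₁ = discover

  visit₂ : Vec ℤ n → V → V → Queue n × (Vec ℤ n × Vec ℕ n) →
           Timed (Queue n × (Vec ℤ n × Vec ℕ n))
  visit₂ dₛ w u (Q , dₜ , σₜ) = do
    (Q , dₜ) ← discover w u (Q , dₜ)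
    b ← closer dₛ u w
    if b then (do
      σₜ ← accumulate w u σₜ
      return (Q , dₜ , σₜ))
     else return (Q , dₜ , σₜ)

  visit₃ : Vec ℤ n → V → V → Queue n × Vec ℕ n → Timed (Queue n × Vec ℕ n)
  visit₃ dₜ w u (Q , σₛ) = do
    b ← closer dₜ u w
    if b then (do
      Q  ← enqueue u Q
      σₛ ← accumulate w u σₛ
      return (Q , σₛ))
     else return (Q , σₛ)

  score : V × V → Vec ℕ n → Vec ℕ n → V → Vec ℚ n → Timed (Vec ℚ n)
  score (s , t) σₛ σₜ w C = do
    b₁ ← op (does (w ≟ s))
    b₂ ← op (does (w ≟ t))
    if b₁ ∨ b₂ then return C else do
      a ← read σₛ w
      b ← read σₜ w
      p ← op (a * b)
      q ← read σₛ t
      x ← op (p ÷ q)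
      y ← read C w
      z ← op (y ℚ.+ x)
      write C w z

  processEdge : Lists → V × V → Vec ℚ n → Timed (Vec ℚ n)
  processEdge Γ (s , t) C = do
    Γ′ ← Γ ∖ (s , t)
    σₛ ← new n 0
    σₜ ← new n 0
    σₛ ← write σₛ s 1
    σₜ ← write σₜ t 1
    dₛ ← new n -1ℤ
    dₜ ← new n -1ℤ
    dₛ ← write dₛ s 0ℤ
    dₜ ← write dₜ t 0ℤ
    Q  ← emptyQueue n
    (Q , dₛ)      ← search Γ′ visit₁ s (Q , dₛ)
    (Q , dₜ , σₜ) ← search Γ′ (visit₂ dₛ) t (Q , dₜ , σₜ)
    (Q , σₛ)      ← search Γ′ (visit₃ dₜ) s (Q , σₛ)
    forEach (allFin n) (score (s , t) σₛ σₜ) C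

-- Unit-cost RAM: an access to an array or queue, a comparison or an arithmetic
-- operation is one step, whatever the size of the numbers involved.
pathCore : (G : Graph) → AdjacencyLists G → Timed (Vec ℚ (Graph.n G))
pathCore G A = do
  C ← new n 0ℚ
  forEach E (processEdge Γ) C
  where
  open Graph G
  open AdjacencyLists A

module Submission where

open import Defs
open import Data.Nat using (ℕ; _*_; _^_; _≤_)
open import Data.Product using (∃-syntax)
open Graph using (n; m)

open import Data.Bool using (true; false; T; if_then_else_; _∨_)
open import Data.Empty using (⊥)
open import Data.Fin using (Fin)
open import Data.Fin.Properties using (_≟_)
open import Data.Integer as ℤ using (ℤ; 0ℤ; 1ℤ; -1ℤ)
import Data.Integer.Properties as ℤ
open import Data.List
  using (List; []; _∷_; _∷ʳ_; _++_; length; map; concatMap; filter; allFin)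
open import Data.List.Membership.Propositional using (_∈_; _∉_)
open import Data.List.Membership.Propositional.Properties
open import Data.List.Properties
  using (length-++; length-++-sucʳ; length-map; length-tabulate; concatMap-++;
         ++-assoc; ++-identityʳ; ∷ʳ-++)
open import Data.List.Relation.Unary.All as All using ([]; _∷_)
import Data.List.Relation.Unary.All.Properties as All
open import Data.List.Relation.Unary.AllPairs as AllPairs using (AllPairs; []; _∷_)
import Data.List.Relation.Unary.AllPairs.Properties as AllPairs
open import Data.List.Relation.Unary.Any using (here; there)
open import Data.List.Relation.Unary.Unique.Propositional using (Unique)
import Data.List.Relation.Unary.Unique.Propositional.Properties as Unique
open import Data.Nat using (suc; zero; _+_; _<_; z≤n; s≤s)
open import Data.Nat.Properties as ℕ
  using (≤-refl; ≤-trans; ≤-reflexive; module ≤-Reasoning)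
open import Data.Nat.Tactic.RingSolver using (solve-∀)
open import Data.Product using (_×_; _,_; proj₁; proj₂; swap)
open import Data.Sum as Sum using (_⊎_; inj₁; inj₂; [_,_]′)
open import Data.Unit using (⊤)
open import Data.Vec using (Vec; lookup; replicate; _[_]≔_)
open import Data.Vec.Properties
  using (lookup∘update; lookup∘update′; lookup-replicate)
open import Function using (_∘_; id; Equivalence)
open import Relation.Binary.PropositionalEquality
  using (_≡_; _≢_; refl; sym; trans; cong; subst; ≢-sym; module ≡-Reasoning)
open import Relation.Nullary using (¬_; Dec; yes; no; does; ¬?; contradiction)
open import Relation.Nullary.Decidable using (T?)

-- In each of the three searches every vertex leaves the queue at most once, so by the
-- handshake lemma a search takes O(n + m) steps; the rest of an iteration takes O(n),
-- and n ≤ K m bounds the m iterations together by O(m²).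
--
-- For the first two searches this is the visited mark.  The third has no such mark.
-- But the second, being breadth-first, leaves distances that differ by at most one
-- along an arc, so the third proceeds in layers of decreasing distance: it reaches
-- a vertex only from the layer before, when that vertex is still waiting or was
-- never enqueued.

-- A Hoare logic of total correctness with step bounds.

record Triple {A : Set} (c : Timed A) (b : ℕ) (Q : A → Set) : Set where
  constructor halts
  field
    {result} : A
    {steps}  : ℕ
    run      : c ⇓ result after steps
    post     : Q result
    bound    : steps ≤ b

module _ {A : Set} where

  charge-rule : ∀ {k a} {Q : A → Set} → Q a → Triple (charge k a) k Q
  charge-rule q = halts (refl , refl) q ≤-refl

  weaken : ∀ {c : Timed A} {i j Q} → i ≤ j → Triple c i Q → Triple c j Q
  weaken i≤j (halts r q k≤i) = halts r q (≤-trans k≤i i≤j)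

  post-map : ∀ {c : Timed A} {i} {Q R : A → Set} → (∀ {a} → Q a → R a) →
             Triple c i Q → Triple c i R
  post-map f (halts r q k≤i) = halts r (f q) k≤i

  -- Programs branch on a Boolean, while invariants need the evidence behind it. For a bare flag `b`
  -- the decision `T? b` serves, its `does` being `b` itself.
  branch : ∀ {P : Set} (P? : Dec P) {c c′ : Timed A} {i Q} →
           (P → Triple c i Q) → (¬ P → Triple c′ i Q) →
           Triple (if does P? then c else c′) i Q
  branch (yes p) f g = f p
  branch (no ¬p) f g = g ¬p

module _ {A B : Set} where

  >>=-rule : ∀ {c : Timed A} {f : A → Timed B} {i j R Q} → Triple c i R →
             (∀ {a} → R a → Triple (f a) j Q) → Triple (c >>= f) (i + j) Q
  >>=-rule (halts r p k≤i) t with t p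
  ... | halts r′ q k′≤j = halts (bind r r′) q (ℕ.+-mono-≤ k≤i k′≤j)

  infixr 1 charged_

  charged_ : ∀ {k a} {f : A → Timed B} {j Q} →
             Triple (f a) j Q → Triple (charge k a >>= f) (k + j) Q
  charged_ {k} (halts r q k′≤j) = halts (bind (refl , refl) r) q (ℕ.+-monoʳ-≤ k k′≤j)

-- `J` is indexed by the elements still to come, so an invariant can speak of the neighbours not yet
-- scanned. Each round pays one step besides `c`, and the empty list pays the last one.
forEach-rule : ∀ {A S : Set} {f : A → S → Timed S} {c} xs (J : List A → S → Set) →
               (∀ {x xs s} → J (x ∷ xs) s → Triple (f x s) c (J xs)) →
               ∀ {s} → J xs s → Triple (forEach xs f s) (suc (suc c * length xs)) (J [])
forEach-rule [] J step j = weaken (s≤s z≤n) (charge-rule j)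
forEach-rule {c = c} (x ∷ xs) J step j =
  weaken (≤-reflexive (arith c (length xs)))
    (charged >>=-rule (step j) (forEach-rule xs J step))
  where
  arith : ∀ c l → 1 + (c + suc (suc c * l)) ≡ suc (suc c * suc l)
  arith = solve-∀

-- Counting with duplicate-free lists.

module _ {A : Set} where

  -- Pigeonhole by induction: `ys` with the head `x` cut out still contains the tail, which avoids
  -- `x`.
  unique-⊆⇒length-≤ : {xs ys : List A} → Unique xs → (∀ {x} → x ∈ xs → x ∈ ys) →
                      length xs ≤ length ys
  unique-⊆⇒length-≤ {[]} _ _ = z≤n
  unique-⊆⇒length-≤ {x ∷ xs} {ys} (x∉xs ∷ xs!) xs⊆ys with ∈-∃++ (xs⊆ys (here refl))
  ... | us , vs , refl = begin
    suc (length xs)        ≤⟨ s≤s (unique-⊆⇒length-≤ xs! xs⊆us++vs) ⟩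
    suc (length (us ++ vs)) ≡⟨ length-++-sucʳ us x vs ⟨
    length (us ++ x ∷ vs)  ∎
    where
    open ≤-Reasoning
    xs⊆us++vs : ∀ {y} → y ∈ xs → y ∈ us ++ vs
    xs⊆us++vs y∈xs with ∈-++⁻ us (xs⊆ys (there y∈xs))
    ... | inj₁ y∈us         = ∈-++⁺ˡ y∈us
    ... | inj₂ (here refl)  = contradiction refl (All.lookup x∉xs y∈xs)
    ... | inj₂ (there y∈vs) = ∈-++⁺ʳ us y∈vs

  allPairs-++⁻ʳ : ∀ {R : A → A → Set} xs {ys} → AllPairs R (xs ++ ys) → AllPairs R ys
  allPairs-++⁻ʳ []       rs       = rs
  allPairs-++⁻ʳ (_ ∷ xs) (_ ∷ rs) = allPairs-++⁻ʳ xs rs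

  allPairs-++⁻ˡ : ∀ {R : A → A → Set} xs {ys} → AllPairs R (xs ++ ys) → AllPairs R xs
  allPairs-++⁻ˡ []       _        = []
  allPairs-++⁻ˡ (_ ∷ xs) (r ∷ rs) = All.++⁻ˡ xs r ∷ allPairs-++⁻ˡ xs rs

  allPairs-∷ʳ⁺ : ∀ {R : A → A → Set} {xs x} → AllPairs R xs → (∀ {y} → y ∈ xs → R y x) →
                 AllPairs R (xs ∷ʳ x)
  allPairs-∷ʳ⁺ rs r = AllPairs.++⁺ rs ([] ∷ []) (All.tabulate (λ y∈xs → r y∈xs ∷ []))

length-unique-≤ : ∀ {n} {vs : List (Fin n)} → Unique vs → length vs ≤ n
length-unique-≤ {n} {vs} vs! =
  subst (length vs ≤_) (length-tabulate id) (unique-⊆⇒length-≤ vs! (λ {v} _ → ∈-allFin v))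

-- Deletion from a neighbour list.

without : ∀ {n} → Fin n → List (Fin n) → List (Fin n)
without v = filter (λ u → ¬? (u ≟ v))

delete-rule : ∀ {n} (v : Fin n) us →
              Triple (delete v us) (suc (2 * length us)) (_≡ without v us)
delete-rule v []       = charge-rule refl
delete-rule v (u ∷ us) =
  weaken (≤-reflexive (arith (length us))) (charged >>=-rule (delete-rule v us) λ where
    refl → keep)
  where
  arith : ∀ l → 1 + (suc (2 * l) + 1) ≡ suc (2 * suc l)
  arith = solve-∀
  keep : Triple (if does (u ≟ v) then return (without v us) else op (u ∷ without v us)) 1
                (_≡ without v (u ∷ us))
  keep with does (u ≟ v)
  ... | true  = weaken z≤n (charge-rule refl)
  ... | false = charge-rule refl

-- The handshake bound and the removal of an edge.

module _ {n : ℕ} where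

  private
    V = Fin n
    Lists = Vec (List V) n

  -- `sound` is an inclusion, so the arcs of a graph still bound its lists after an edge is removed.
  -- `symmetric` later lets an arc be followed backwards.
  record Network (arcs : List (V × V)) (Γ : Lists) : Set where
    field
      unique    : ∀ v → Unique (lookup Γ v)
      sound     : ∀ {u v} → u ∈ lookup Γ v → (v , u) ∈ arcs
      symmetric : ∀ {u v} → u ∈ lookup Γ v → v ∈ lookup Γ u

  outArcs : Lists → V → List (V × V)
  outArcs Γ v = map (v ,_) (lookup Γ v)

  -- Arcs out of different vertices differ in source, those out of one vertex in target, and all of
  -- them lie in `arcs`.
  length-outArcs-≤ : ∀ {arcs Γ vs} → Network arcs Γ → Unique vs →
                     length (concatMap (outArcs Γ) vs) ≤ length arcs
  length-outArcs-≤ {arcs} {Γ} {vs} N vs! = unique-⊆⇒length-≤ arcs! arcs⊆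
    where
    open Network N
    arcs! : Unique (concatMap (outArcs Γ) vs)
    arcs! = Unique.concat⁺
      (All.map⁺ (All.universal (λ v → Unique.map⁺ (cong proj₂) (unique v)) vs))
      (AllPairs.map⁺ (AllPairs.map (λ v≢w {_} (p , q) → v≢w (sources p q)) vs!))
      where
      sources : ∀ {v w a us us′} → a ∈ map (v ,_) us → a ∈ map (w ,_) us′ → v ≡ w
      sources p q with ∈-map⁻ _ p | ∈-map⁻ _ q
      ... | _ , _ , refl | _ , _ , refl = refl
    arcs⊆ : ∀ {a} → a ∈ concatMap (outArcs Γ) vs → a ∈ arcs
    arcs⊆ a∈ with ∈-concat⁻′ (map (outArcs Γ) vs) a∈
    ... | _ , a∈out , out∈ with ∈-map⁻ (outArcs Γ) out∈
    ... | v , _ , refl with ∈-map⁻ (v ,_) a∈out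
    ... | u , u∈Γv , refl = sound u∈Γv

  module _ (Γ : Lists) (a b : V) where

    shorten : Lists
    shorten = Γ [ a ]≔ without b (lookup Γ a)

    ∈-shorten⁻ : ∀ {u v} → u ∈ lookup shorten v → u ∈ lookup Γ v × (v , u) ≢ (a , b)
    ∈-shorten⁻ {u} {v} u∈ with v ≟ a
    ... | no v≢a = subst (u ∈_) (lookup∘update′ v≢a Γ _) u∈ , v≢a ∘ cong proj₁
    ... | yes refl
      with ∈-filter⁻ (λ u → ¬? (u ≟ b)) (subst (u ∈_) (lookup∘update a Γ _) u∈)
    ... | u∈Γa , u≢b = u∈Γa , u≢b ∘ cong proj₂

    ∈-shorten⁺ : ∀ {u v} → u ∈ lookup Γ v → (v , u) ≢ (a , b) → u ∈ lookup shorten v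
    ∈-shorten⁺ {u} {v} u∈ vu≢ab with v ≟ a
    ... | no v≢a   = subst (u ∈_) (sym (lookup∘update′ v≢a Γ _)) u∈
    ... | yes refl = subst (u ∈_) (sym (lookup∘update a Γ _))
                       (∈-filter⁺ (λ u → ¬? (u ≟ b)) u∈ (vu≢ab ∘ cong (a ,_)))

    unique-shorten : (∀ v → Unique (lookup Γ v)) → ∀ v → Unique (lookup shorten v)
    unique-shorten Γ! v with v ≟ a
    ... | no v≢a   = subst Unique (sym (lookup∘update′ v≢a Γ _)) (Γ! v)
    ... | yes refl = subst Unique (sym (lookup∘update a Γ _))
                       (Unique.filter⁺ (λ u → ¬? (u ≟ b)) (Γ! a))

  -- Symmetry survives because both orientations are cut: if the reverse of a remaining arc were one
  -- of the two, the arc itself would be the other.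
  network-∖ : ∀ {arcs Γ} s t → Network arcs Γ → Network arcs (shorten (shorten Γ s t) t s)
  network-∖ {Γ = Γ} s t N = record
    { unique    = unique-shorten Γ₁ t s (unique-shorten Γ s t unique)
    ; sound     = λ {u} {v} u∈ →
        sound (proj₁ (∈-shorten⁻ Γ s t {u} {v} (proj₁ (∈-shorten⁻ Γ₁ t s u∈))))
    ; symmetric = λ {u} {v} u∈ →
        let u∈₁ , vu≢ts = ∈-shorten⁻ Γ₁ t s u∈
            u∈₂ , vu≢st = ∈-shorten⁻ Γ s t {u} {v} u∈₁
        in ∈-shorten⁺ Γ₁ t s
             (∈-shorten⁺ Γ s t (symmetric u∈₂) (vu≢ts ∘ cong swap)) (vu≢st ∘ cong swap)
    }
    where
    open Network N
    Γ₁ = shorten Γ s t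

  ∖-rule : ∀ {arcs Γ} s t → Network arcs Γ →
           Triple (Γ ∖ (s , t)) (5 * n + 6) (Network arcs)
  ∖-rule {Γ = Γ} s t N =
    weaken (≤-reflexive (arith n))
    (charged charged >>=-rule (shortList t (unique s)) λ where
       refl → charged charged
         >>=-rule (shortList s (unique-shorten Γ s t unique t)) λ where
           refl → charge-rule (network-∖ s t N))
    where
    open Network N
    arith : ∀ n → n + (1 + (suc (2 * n) + (1 + (1 + (suc (2 * n) + 1))))) ≡ 5 * n + 6
    arith = solve-∀
    shortList : ∀ v {us} → Unique us → Triple (delete v us) (suc (2 * n)) (_≡ without v us)
    shortList v {us} us! =
      weaken (s≤s (ℕ.*-monoʳ-≤ 2 (length-unique-≤ us!))) (delete-rule v us)

-- Arithmetic of keys that differ by one.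

private
  i+1-mono : ∀ {i j} → i ℤ.≤ j → i ℤ.+ 1ℤ ℤ.≤ j ℤ.+ 1ℤ
  i+1-mono = ℤ.+-monoˡ-≤ 1ℤ

  i≤i+1 : ∀ {i} → i ℤ.≤ i ℤ.+ 1ℤ
  i≤i+1 {i} = ℤ.i≤i+j i 1ℤ

  i<j⇒i+1≤j : ∀ {i j} → i ℤ.< j → i ℤ.+ 1ℤ ℤ.≤ j
  i<j⇒i+1≤j {i} i<j = subst (ℤ._≤ _) (ℤ.+-comm 1ℤ i) (ℤ.i<j⇒suc[i]≤j i<j)

  i<i+1 : ∀ {i} → i ℤ.< i ℤ.+ 1ℤ
  i<i+1 {i} = ℤ.suc[i]≤j⇒i<j (ℤ.≤-reflexive (ℤ.+-comm 1ℤ i))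

  -- For the third search, where a fall of the distance by one is a rise of the key `- d` by one.
  neg-flip-+1 : ∀ {i j} → i ≡ j ℤ.+ 1ℤ → ℤ.- j ≡ ℤ.- i ℤ.+ 1ℤ
  neg-flip-+1 {_} {j} refl = sym (begin
    ℤ.- (j ℤ.+ 1ℤ) ℤ.+ 1ℤ        ≡⟨ cong (ℤ._+ 1ℤ) (ℤ.neg-distrib-+ j 1ℤ) ⟩
    (ℤ.- j ℤ.+ -1ℤ) ℤ.+ 1ℤ       ≡⟨ ℤ.+-assoc (ℤ.- j) -1ℤ 1ℤ ⟩
    ℤ.- j ℤ.+ 0ℤ                 ≡⟨ ℤ.+-identityʳ (ℤ.- j) ⟩
    ℤ.- j                        ∎)
    where open ≡-Reasoning

-- Invariants of the queue.

module _ {n : ℕ} where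

  private
    V = Fin n
    Lists = Vec (List V) n

  open Queue

  -- The three searches share one queue, and a flag left raised would suppress a later enqueue.
  Idle : Queue n → Set
  Idle Q = items Q ≡ [] × (∀ u → ¬ T (lookup (waiting Q) u))

  -- A search handles vertices in the order of the key e.  Those in done have left
  -- the queue, and those in the queue have keys k or k + 1.
  record Frontier (e : V → ℤ) (k : ℤ) (done : List V) (Q : Queue n) : Set where
    field
      distinct : Unique (done ++ items Q)
      marked   : ∀ {u} → u ∈ items Q → T (lookup (waiting Q) u)
      genuine  : ∀ {u} → T (lookup (waiting Q) u) → u ∈ items Q
      behind   : ∀ {u} → u ∈ done → e u ℤ.≤ k
      ahead    : ∀ {u} → u ∈ items Q → k ℤ.≤ e u
      near     : ∀ {u} → u ∈ items Q → e u ℤ.≤ k ℤ.+ 1ℤ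
      sorted   : AllPairs (λ u v → e u ℤ.≤ e v) (items Q)

  idle⇒frontier : ∀ {e k Q} → Idle Q → Frontier e k [] Q
  idle⇒frontier (refl , unmarked) = record
    { distinct = []
    ; marked   = λ ()
    ; genuine  = λ {u} tt → contradiction tt (unmarked u)
    ; behind   = λ ()
    ; ahead    = λ ()
    ; near     = λ ()
    ; sorted   = []
    }

  frontier⇒idle : ∀ {e k done Q} → Frontier e k done Q → items Q ≡ [] → Idle Q
  frontier⇒idle F refl = refl , λ _ tt → contradiction (Frontier.genuine F tt) λ ()

  -- Meant for `discover`, whose write changes the key of a vertex outside `done` and the queue.
  frontier-cong : ∀ {e e′ k done Q} → (∀ {u} → u ∈ done ++ items Q → e′ u ≡ e u) →
                  Frontier e k done Q → Frontier e′ k done Q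
  frontier-cong {e} {e′} {k} {done} {Q} e′≗e F = record
    { distinct = distinct
    ; marked   = marked
    ; genuine  = genuine
    ; behind   = λ u∈ → subst (ℤ._≤ k) (sym (e′≗e (∈-++⁺ˡ u∈))) (behind u∈)
    ; ahead    = λ u∈ → subst (k ℤ.≤_) (sym (on-items u∈)) (ahead u∈)
    ; near     = λ u∈ → subst (ℤ._≤ k ℤ.+ 1ℤ) (sym (on-items u∈)) (near u∈)
    ; sorted   = resort (items Q) on-items sorted
    }
    where
    open Frontier F
    on-items : ∀ {u} → u ∈ items Q → e′ u ≡ e u
    on-items u∈ = e′≗e (∈-++⁺ʳ done u∈)
    resort : ∀ us → (∀ {u} → u ∈ us → e′ u ≡ e u) →
             AllPairs (λ u v → e u ℤ.≤ e v) us → AllPairs (λ u v → e′ u ℤ.≤ e′ v) us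
    resort []       _  []       = []
    resort (u ∷ us) eq (r ∷ rs) =
      All.tabulate (λ {v} v∈ →
        subst (ℤ._≤ e′ v) (sym (eq (here refl)))
          (subst (e u ℤ.≤_) (sym (eq (there v∈))) (All.lookup r v∈)))
      ∷ resort us (eq ∘ there) rs

  -- `w` is a minimum of the sorted queue, so its key can replace `k`: the rest is at least `e w`
  -- and at most `k + 1`, hence at most `e w + 1`, and `done` stays at or below `k`, hence `e w`.
  frontier-pop : ∀ {e k done w us flags} → Frontier e k done (queue (w ∷ us) flags) →
                 Frontier e (e w) (done ∷ʳ w) (queue us (flags [ w ]≔ false))
  frontier-pop {e} {k} {done} {w} {us} {flags} F = record
    { distinct = subst Unique (sym (∷ʳ-++ done w us)) distinct
    ; marked   = λ u∈ → subst T (sym (lookup∘update′ (≢w u∈) flags false)) (marked (there u∈))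
    ; genuine  = still-waiting
    ; behind   = λ u∈ → [ (λ u∈done → ℤ.≤-trans (behind u∈done) (ahead (here refl)))
                        , (λ where (here refl) → ℤ.≤-refl) ]′ (∈-++⁻ done u∈)
    ; ahead    = λ u∈ → All.lookup (AllPairs.head sorted) u∈
    ; near     = λ u∈ → ℤ.≤-trans (near (there u∈)) (i+1-mono (ahead (here refl)))
    ; sorted   = AllPairs.tail sorted
    }
    where
    open Frontier F
    ≢w : ∀ {u} → u ∈ us → u ≢ w
    ≢w u∈ = ≢-sym (All.lookup (AllPairs.head (allPairs-++⁻ʳ done distinct)) u∈)
    still-waiting : ∀ {u} → T (lookup (flags [ w ]≔ false) u) → u ∈ us
    still-waiting {u} tt with u ≟ w
    ... | yes refl = contradiction (subst T (lookup∘update w flags false) tt) id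
    ... | no u≢w with genuine (subst T (lookup∘update′ u≢w flags false) tt)
    ...   | here u≡w = contradiction u≡w u≢w
    ...   | there u∈ = u∈

  record Enqueued (u : V) (Q Q′ : Queue n) : Set where
    field
      added : u ∈ items Q′
      kept  : ∀ {v} → v ∈ items Q → v ∈ items Q′
      only  : ∀ {v} → v ∈ items Q′ → v ∈ items Q ⊎ v ≡ u

  -- `k + 1` is the largest key that `near` allows, so appending keeps the queue sorted. A raised
  -- flag means that `u` is waiting and nothing changes; a lowered one, with `u ∉ done`, keeps the
  -- vertices distinct.
  enqueue-rule : ∀ {e k done u Q} → Frontier e k done Q → u ∉ done → e u ≡ k ℤ.+ 1ℤ →
                 Triple (enqueue u Q) 3 (λ Q′ → Frontier e k done Q′ × Enqueued u Q Q′)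
  enqueue-rule {e} {k} {done} {u} {queue us flags} F u∉done eᵤ =
    charged branch (T? (lookup flags u))
      (λ tt → weaken z≤n (charge-rule
        (F , record { added = genuine tt ; kept = id ; only = inj₁ })))
      (λ unmarked → charged charge-rule (pushed unmarked , record
        { added = ∈-++⁺ʳ us (here refl)
        ; kept  = ∈-++⁺ˡ
        ; only  = only′
        }))
    where
    open Frontier F
    only′ : ∀ {v} → v ∈ us ∷ʳ u → v ∈ us ⊎ v ≡ u
    only′ v∈ = Sum.map₂ (λ where (here v≡u) → v≡u) (∈-++⁻ us v∈)
    pushed : ¬ T (lookup flags u) → Frontier e k done (queue (us ∷ʳ u) (flags [ u ]≔ true))
    pushed unmarked = record
      { distinct = subst Unique (++-assoc done us (u ∷ []))
          (allPairs-∷ʳ⁺ distinct λ v∈ v≡u → u∉ (subst (_∈ done ++ us) v≡u v∈))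
      ; marked   = marked′
      ; genuine  = genuine′
      ; behind   = behind
      ; ahead    = λ v∈ → [ ahead , (λ where refl → subst (k ℤ.≤_) (sym eᵤ) i≤i+1) ]′ (only′ v∈)
      ; near     = λ v∈ → [ near , (λ where refl → ℤ.≤-reflexive eᵤ) ]′ (only′ v∈)
      ; sorted   = allPairs-∷ʳ⁺ sorted (λ {v} v∈ → subst (e v ℤ.≤_) (sym eᵤ) (near v∈))
      }
      where
      u∉ : u ∉ done ++ us
      u∉ u∈ = [ u∉done , unmarked ∘ marked ]′ (∈-++⁻ done u∈)
      marked′ : ∀ {v} → v ∈ us ∷ʳ u → T (lookup (flags [ u ]≔ true) v)
      marked′ {v} v∈ with v ≟ u
      ... | yes refl = subst T (sym (lookup∘update u flags true)) _
      ... | no v≢u   = subst T (sym (lookup∘update′ v≢u flags true))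
                         ([ marked , (λ v≡u → contradiction v≡u v≢u) ]′ (only′ v∈))
      genuine′ : ∀ {v} → T (lookup (flags [ u ]≔ true) v) → v ∈ us ∷ʳ u
      genuine′ {v} tt with v ≟ u
      ... | yes refl = ∈-++⁺ʳ us (here refl)
      ... | no v≢u   = ∈-++⁺ˡ (genuine (subst T (lookup∘update′ v≢u flags true) tt))

  -- The cost of a search in which no vertex leaves the queue twice.

  module _ {X : Set} {arcs Γ} {visit : V → V → Queue n × X → Timed (Queue n × X)} {c}
    (N : Network arcs Γ) (Inv : List V → Queue n × X → Set)
    (distinct : ∀ {done Q x} → Inv done (Q , x) → Unique (done ++ items Q))
    (step : ∀ {done w us flags x} → Inv done (queue (w ∷ us) flags , x) →
            Triple (forEach (lookup Γ w) (visit w) (queue us (flags [ w ]≔ false) , x))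
                   (suc (suc c * length (lookup Γ w))) (Inv (done ∷ʳ w)))
    where

    private
      Drained : Queue n × X → Set
      Drained s = ∃[ done ] Inv done s × items (proj₁ s) ≡ []

      -- Besides its scan, a dequeued vertex costs 2 steps of dequeue, the read of its
      -- list and the end of the forEach.
      work : List V → ℕ
      work vs = 4 * length vs + suc c * length (concatMap (outArcs Γ) vs)

      total : ℕ
      total = 4 * n + suc c * length arcs

      work-∷ʳ : ∀ vs w → work (vs ∷ʳ w) ≡ work vs + (4 + suc c * length (lookup Γ w))
      work-∷ʳ vs w
        rewrite length-++ vs {w ∷ []}
              | concatMap-++ (outArcs Γ) vs (w ∷ [])
              | ++-identityʳ (outArcs Γ w)
              | length-++ (concatMap (outArcs Γ) vs) {outArcs Γ w}
              | length-map (w ,_) (lookup Γ w)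
        = arith (length vs) (length (concatMap (outArcs Γ) vs)) (length (lookup Γ w)) c
        where
        arith : ∀ a b l c → 4 * (a + 1) + suc c * (b + l) ≡
                            (4 * a + suc c * b) + (4 + suc c * l)
        arith = solve-∀

      work-≤ : ∀ {done us} → Unique (done ++ us) → work done ≤ total
      work-≤ {done} vs! = ℕ.+-mono-≤
        (ℕ.*-monoʳ-≤ 4 (length-unique-≤ done!))
        (ℕ.*-monoʳ-≤ (suc c) (length-outArcs-≤ N done!))
        where done! = allPairs-++⁻ˡ done vs!

      -- `done` is a ghost variable, and `work done` a potential: the steps to come plus the work
      -- already accounted for stay within the total. `fuel` bounds the number of vertices that have
      -- yet to leave the queue and makes the recursion structural.
      loop-rule : ∀ fuel {done s} → n ≤ length done + fuel → Inv done s →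
        ∃[ s′ ] ∃[ k ]
          (while dequeue (λ (w , Q , x) → read Γ w >>= λ us → forEach us (visit w) (Q , x)) s
             ⇓ s′ after k)
          × Drained s′ × k + work done ≤ suc total
      loop-rule fuel {done} {queue [] flags , x} _ I =
        _ , _ , exit (refl , refl) , (done , I , refl) , s≤s (work-≤ {us = []} (distinct I))
      -- Without fuel `done` has at least `n` vertices, so one more in the queue makes too many
      -- distinct ones.
      loop-rule zero {done} {queue (w ∷ us) flags , x} n≤ I =
        contradiction too-long (ℕ.<-irrefl refl)
        where
        open ≤-Reasoning
        too-long : n < n
        too-long = begin-strict
          n                              ≤⟨ n≤ ⟩
          length done + 0                <⟨ ℕ.+-monoʳ-< (length done) (s≤s z≤n) ⟩
          length done + length (w ∷ us)  ≡⟨ length-++ done ⟨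
          length (done ++ w ∷ us)        ≤⟨ length-unique-≤ (distinct I) ⟩
          n                              ∎
      loop-rule (suc fuel) {done} {queue (w ∷ us) flags , x} n≤ I with step I
      ... | halts {steps = j} r I′ j≤
        with loop-rule fuel (subst (n ≤_) longer n≤) I′
        where
        longer : length done + suc fuel ≡ length (done ∷ʳ w) + fuel
        longer = trans (sym (ℕ.+-assoc (length done) 1 fuel))
                       (cong (_+ fuel) (sym (length-++ done)))
      ... | s′ , k , rs , drained , k≤ =
        s′ , _ ,
        loop (bind (refl , refl) (refl , refl)) (bind (refl , refl) r) rs , drained ,
        (begin
          2 + (1 + j) + k + work done              ≤⟨ ℕ.+-monoˡ-≤ (work done)
                                                        (ℕ.+-monoˡ-≤ k (s≤s (s≤s (s≤s j≤)))) ⟩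
          4 + suc c * l + k + work done            ≡⟨ arith (suc c * l) k (work done) ⟩
          k + (work done + (4 + suc c * l))        ≡⟨ cong (k +_) (work-∷ʳ done w) ⟨
          k + work (done ∷ʳ w)                     ≤⟨ k≤ ⟩
          suc total                                ∎)
        where
        open ≤-Reasoning
        l = length (lookup Γ w)
        arith : ∀ a k b → 4 + a + k + b ≡ k + (b + (4 + a))
        arith = solve-∀

    -- Of the final 4, 3 pay for enqueueing the root and 1 for the `dequeue` that finds the queue
    -- empty.
    search-rule : ∀ {r Q x} → Triple (enqueue r Q) 3 (λ Q′ → Inv [] (Q′ , x)) →
                  Triple (search Γ visit r (Q , x)) (4 * n + suc c * length arcs + 4)
                    (λ s → ∃[ done ] Inv done s × items (proj₁ s) ≡ [])
    search-rule t = weaken (≤-reflexive (arith (4 * n) (suc c * length arcs)))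
      (>>=-rule t λ I →
        let _ , k , run , drained , k≤ = loop-rule n ≤-refl I
        in halts run drained (≤-trans (ℕ.m≤m+n k _) k≤))
      where
      arith : ∀ a b → 3 + suc (a + b) ≡ a + b + 4
      arith = solve-∀

  -- Breadth-first search and its layers.

  Layered : Lists → Vec ℤ n → Set
  Layered Γ d = ∀ {w u} → u ∈ lookup Γ w → lookup d u ℤ.< lookup d w →
                lookup d w ≡ lookup d u ℤ.+ 1ℤ

  module _ (Γ : Lists) where

    -- An arc w → u out of a finished vertex w has been followed, unless it is pending.
    record Bfs (pending : V → V → Set) (k : ℤ) (done : List V)
               (Q : Queue n) (d : Vec ℤ n) : Set where
      field
        frontier : Frontier (lookup d) k done Q
        reached  : ∀ {u} → u ∈ done ++ items Q → 0ℤ ℤ.≤ lookup d u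
        recorded : ∀ {u} → 0ℤ ℤ.≤ lookup d u → u ∈ done ++ items Q
        floor    : ∀ u → -1ℤ ℤ.≤ lookup d u
        followed : ∀ {w u} → w ∈ done → u ∈ lookup Γ w →
                   (0ℤ ℤ.≤ lookup d u × lookup d u ℤ.≤ lookup d w ℤ.+ 1ℤ) ⊎ pending w u
      open Frontier frontier public

    -- The pending arcs are those from `w` to `us`. Through `level`, the value `d w + 1` assigned on
    -- discovery is the key `k + 1` that `enqueue-rule` asks for.
    record Scanning (w : V) (k : ℤ) (done us : List V) (Q : Queue n) (d : Vec ℤ n) : Set where
      constructor scanning
      field
        bfs   : Bfs (λ v u → v ≡ w × u ∈ us) k done Q d
        w∈    : w ∈ done
        level : lookup d w ≡ k

    bfs-start : ∀ {r d Q} → Idle Q → lookup d r ≡ 0ℤ → (∀ {u} → u ≢ r → lookup d u ≡ -1ℤ) →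
                Triple (enqueue r Q) 3 (λ Q′ → Bfs (λ _ _ → ⊥) -1ℤ [] Q′ d)
    bfs-start {r} {d} {Q} idle dᵣ dᵤ =
      -- Level -1 puts the root, at distance 0, on level `k + 1`; `dᵣ` fits because `-1ℤ + 1ℤ`
      -- computes to `0ℤ`.
      post-map init (enqueue-rule (idle⇒frontier idle) (λ ()) dᵣ)
      where
      init : ∀ {Q′} → Frontier (lookup d) -1ℤ [] Q′ × Enqueued r Q Q′ →
             Bfs (λ _ _ → ⊥) -1ℤ [] Q′ d
      init {Q′} (F , E) = record
        { frontier = F
        ; reached  = λ u∈ → case-only (only u∈)
        ; recorded = recorded
        ; floor    = floor
        ; followed = λ ()
        }
        where
        open Enqueued E
        case-only : ∀ {u} → u ∈ items Q ⊎ u ≡ r → 0ℤ ℤ.≤ lookup d u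
        case-only (inj₁ u∈)   = contradiction (subst (_ ∈_) (proj₁ idle) u∈) λ ()
        case-only (inj₂ refl) = ℤ.≤-reflexive (sym dᵣ)
        recorded : ∀ {u} → 0ℤ ℤ.≤ lookup d u → u ∈ items Q′
        recorded {u} 0≤ with u ≟ r
        ... | yes refl = added
        ... | no u≢r   = contradiction (subst (0ℤ ℤ.≤_) (dᵤ u≢r) 0≤) λ ()
        floor : ∀ u → -1ℤ ℤ.≤ lookup d u
        floor u with u ≟ r
        ... | yes refl = subst (-1ℤ ℤ.≤_) (sym dᵣ) ℤ.-≤+
        ... | no u≢r   = ℤ.≤-reflexive (sym (dᵤ u≢r))

    bfs-pop : ∀ {k done w us flags d} → Bfs (λ _ _ → ⊥) k done (queue (w ∷ us) flags) d →
              Scanning w (lookup d w) (done ∷ʳ w) (lookup Γ w)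
                       (queue us (flags [ w ]≔ false)) d
    bfs-pop {done = done} {w} {us} {flags} {d} B = scanning
      (record
        { frontier = frontier-pop frontier
        ; reached  = λ u∈ → reached (subst (_ ∈_) (∷ʳ-++ done w us) u∈)
        ; recorded = λ 0≤ → subst (_ ∈_) (sym (∷ʳ-++ done w us)) (recorded 0≤)
        ; floor    = floor
        ; followed = λ v∈ u∈ → case-∷ʳ u∈ (∈-++⁻ done v∈)
        })
      (∈-++⁺ʳ done (here refl)) refl
      where
      open Bfs B
      case-∷ʳ : ∀ {v u} → u ∈ lookup Γ v → v ∈ done ⊎ v ∈ w ∷ [] →
                (0ℤ ℤ.≤ lookup d u × lookup d u ℤ.≤ lookup d v ℤ.+ 1ℤ) ⊎
                (v ≡ w × u ∈ lookup Γ w)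
      case-∷ʳ u∈ (inj₁ v∈)          = Sum.map₂ (λ ()) (followed v∈ u∈)
      case-∷ʳ u∈ (inj₂ (here refl)) = inj₂ (refl , u∈)

    scanned : ∀ {w k done Q d} → Scanning w k done [] Q d → Bfs (λ _ _ → ⊥) k done Q d
    scanned S = record
      { frontier = frontier ; reached = reached ; recorded = recorded ; floor = floor
      ; followed = λ v∈ u∈ → Sum.map₂ (λ ()) (followed v∈ u∈) }
      where open Bfs (Scanning.bfs S)

    -- If `u` has a distance already, it is in `done` (at most `k`) or in the queue (at most
    -- `k + 1`), so its arc obeys the bound. Otherwise it lies outside both, and the write disturbs
    -- no key there. The 8 steps are 2 for the test, 3 for the enqueue and 3 for the update.
    discover-rule : ∀ {w k done u us Q d} → Scanning w k done (u ∷ us) Q d →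
                    Triple (discover w u (Q , d)) 8
                      (λ (Q′ , d′) → Scanning w k done us Q′ d′)
    discover-rule {w} {k} {done} {u} {us} {Q} {d} (scanning B w∈ level) =
      charged charged branch (lookup d u ℤ.<? 0ℤ) fresh
        (λ dᵤ≮0 → weaken z≤n (charge-rule (seen (ℤ.≮⇒≥ dᵤ≮0))))
      where
      open Bfs B
      Step : V → V → Vec ℤ n → Set
      Step v x d = 0ℤ ℤ.≤ lookup d x × lookup d x ℤ.≤ lookup d v ℤ.+ 1ℤ

      seen : 0ℤ ℤ.≤ lookup d u → Scanning w k done us Q d
      seen 0≤dᵤ = scanning
        (record { frontier = frontier ; reached = reached ; recorded = recorded
                ; floor = floor
                ; followed = λ v∈ x∈ → followed′ (followed v∈ x∈) })
        w∈ level
        where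
        dᵤ≤k+1 : lookup d u ℤ.≤ k ℤ.+ 1ℤ
        dᵤ≤k+1 = [ (λ u∈ → ℤ.≤-trans (behind u∈) i≤i+1) , near ]′ (∈-++⁻ done (recorded 0≤dᵤ))
        followed′ : ∀ {v x} → Step v x d ⊎ (v ≡ w × x ∈ u ∷ us) → Step v x d ⊎ (v ≡ w × x ∈ us)
        followed′ (inj₁ s)                    = inj₁ s
        followed′ (inj₂ (refl , here refl))   =
          inj₁ (0≤dᵤ , subst (λ i → _ ℤ.≤ i ℤ.+ 1ℤ) (sym level) dᵤ≤k+1)
        followed′ (inj₂ (v≡w , there x∈))     = inj₂ (v≡w , x∈)

      fresh : lookup d u ℤ.< 0ℤ → Triple _ 6 (λ (Q′ , d′) → Scanning w k done us Q′ d′)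
      fresh dᵤ<0 = >>=-rule
        -- The program enqueues before it writes. As enqueueing does not look at distances, the
        -- frontier passes to the new keys `d′` beforehand.
        (enqueue-rule (frontier-cong old frontier) (u∉ ∘ ∈-++⁺ˡ) d′ᵤ)
        (λ FE → charged charged charged charge-rule (extended FE))
        where
        d′ = d [ u ]≔ (lookup d w ℤ.+ 1ℤ)
        u∉ : u ∉ done ++ items Q
        u∉ u∈ = ℤ.≤⇒≯ (reached u∈) dᵤ<0
        old : ∀ {v} → v ∈ done ++ items Q → lookup d′ v ≡ lookup d v
        old v∈ = lookup∘update′ (λ where refl → u∉ v∈) d _
        d′ᵤ : lookup d′ u ≡ k ℤ.+ 1ℤ
        d′ᵤ = trans (lookup∘update u d _) (cong (ℤ._+ 1ℤ) level)
        level′ : lookup d′ w ≡ k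
        level′ = trans (old (∈-++⁺ˡ w∈)) level
        0≤d′ᵤ : 0ℤ ℤ.≤ lookup d′ u
        0≤d′ᵤ = subst (0ℤ ℤ.≤_) (sym (lookup∘update u d _))
                  (ℤ.≤-trans (reached (∈-++⁺ˡ w∈)) i≤i+1)
        extended : ∀ {Q′} → Frontier (lookup d′) k done Q′ × Enqueued u Q Q′ →
                   Scanning w k done us Q′ d′
        extended {Q′} (F , E) = scanning
          (record
            { frontier = F
            ; reached  = λ v∈ → reached′ (∈-++⁻ done v∈)
            ; recorded = recorded′
            ; floor    = floor′
            ; followed = λ v∈ x∈ → followed′ v∈ (followed v∈ x∈)
            })
          w∈ level′
          where
          open Enqueued E
          kept-reached : ∀ {v} → v ∈ done ++ items Q → 0ℤ ℤ.≤ lookup d′ v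
          kept-reached v∈ = subst (0ℤ ℤ.≤_) (sym (old v∈)) (reached v∈)
          reached′ : ∀ {v} → v ∈ done ⊎ v ∈ items Q′ → 0ℤ ℤ.≤ lookup d′ v
          reached′ (inj₁ v∈) = kept-reached (∈-++⁺ˡ v∈)
          reached′ (inj₂ v∈) with only v∈
          ... | inj₁ v∈Q  = kept-reached (∈-++⁺ʳ done v∈Q)
          ... | inj₂ refl = 0≤d′ᵤ
          recorded′ : ∀ {v} → 0ℤ ℤ.≤ lookup d′ v → v ∈ done ++ items Q′
          recorded′ {v} 0≤ with v ≟ u
          ... | yes refl = ∈-++⁺ʳ done added
          ... | no v≢u   =
            [ ∈-++⁺ˡ , ∈-++⁺ʳ done ∘ kept ]′
              (∈-++⁻ done (recorded (subst (0ℤ ℤ.≤_) (lookup∘update′ v≢u d _) 0≤)))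
          floor′ : ∀ v → -1ℤ ℤ.≤ lookup d′ v
          floor′ v with v ≟ u
          ... | yes refl = ℤ.≤-trans ℤ.-≤+ 0≤d′ᵤ
          ... | no v≢u   = subst (-1ℤ ℤ.≤_) (sym (lookup∘update′ v≢u d _)) (floor v)
          followed′ : ∀ {v x} → v ∈ done → Step v x d ⊎ (v ≡ w × x ∈ u ∷ us) →
                      Step v x d′ ⊎ (v ≡ w × x ∈ us)
          followed′ {v} {x} v∈ (inj₁ (0≤ , dₓ≤)) = inj₁
            ( kept-reached (recorded 0≤)
            , subst (ℤ._≤ lookup d′ v ℤ.+ 1ℤ) (sym (old (recorded 0≤)))
                (subst (λ i → lookup d x ℤ.≤ i ℤ.+ 1ℤ) (sym (old (∈-++⁺ˡ v∈))) dₓ≤))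
          followed′ _ (inj₂ (refl , here refl)) = inj₁
            (0≤d′ᵤ , ℤ.≤-reflexive (trans d′ᵤ (cong (ℤ._+ 1ℤ) (sym level′))))
          followed′ _ (inj₂ (v≡w , there x∈)) = inj₂ (v≡w , x∈)

  -- From `d u < d w` and the floor -1 follows `0 ≤ d w`, so `w` is finished and its neighbour `u`
  -- reached, hence finished as well. The reverse arc was therefore followed, which gives
  -- `d w ≤ d u + 1`; integrality gives the converse.
  bfs⇒layered : ∀ {arcs Γ k done Q d} → Network arcs Γ →
                Bfs Γ (λ _ _ → ⊥) k done Q d → items Q ≡ [] → Layered Γ d
  bfs⇒layered {Γ = Γ} {done = done} {d = d} N B refl {w} {u} u∈ dᵤ<d =
    ℤ.≤-antisym (proj₂ (follow (finished 0≤dᵤ) (Network.symmetric N u∈))) dᵤ+1≤d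
    where
    open Bfs B
    finished : ∀ {v} → 0ℤ ℤ.≤ lookup d v → v ∈ done
    finished 0≤ = subst (_ ∈_) (++-identityʳ done) (recorded 0≤)
    follow : ∀ {v x} → v ∈ done → x ∈ lookup Γ v →
             0ℤ ℤ.≤ lookup d x × lookup d x ℤ.≤ lookup d v ℤ.+ 1ℤ
    follow v∈ x∈ = [ id , (λ ()) ]′ (followed v∈ x∈)
    dᵤ+1≤d : lookup d u ℤ.+ 1ℤ ℤ.≤ lookup d w
    dᵤ+1≤d = i<j⇒i+1≤j dᵤ<d
    0≤dᵤ : 0ℤ ℤ.≤ lookup d u
    0≤dᵤ = proj₁ (follow (finished (ℤ.≤-trans (i+1-mono (floor u)) dᵤ+1≤d)) u∈)

  -- `dist` projects the distances out of the state, so one proof serves the first search and the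
  -- second, which also carries `σₜ`.
  bfs-rule : ∀ {X arcs Γ visit c} (dist : X → Vec ℤ n) → Network arcs Γ →
    (∀ {w k done u us Q x} → Scanning Γ w k done (u ∷ us) Q (dist x) →
     Triple (visit w u (Q , x)) c (λ (Q′ , x′) → Scanning Γ w k done us Q′ (dist x′))) →
    ∀ {r Q x} → Idle Q → lookup (dist x) r ≡ 0ℤ → (∀ {u} → u ≢ r → lookup (dist x) u ≡ -1ℤ) →
    Triple (search Γ visit r (Q , x)) (4 * n + suc c * length arcs + 4)
      (λ (Q′ , x′) → Idle Q′ × Layered Γ (dist x′))
  bfs-rule {X} {Γ = Γ} {visit} {c} dist N visit-rule idle dᵣ dᵤ =
    post-map (λ (_ , (_ , B) , drained) →
                frontier⇒idle (Bfs.frontier B) drained , bfs⇒layered N B drained)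
      (search-rule {visit = visit} {c = c} N Inv (λ (_ , B) → Bfs.distinct B) step
        (post-map (-1ℤ ,_) (bfs-start Γ idle dᵣ dᵤ)))
    where
    Inv : List V → Queue n × X → Set
    Inv done (Q , x) = ∃[ k ] Bfs Γ (λ _ _ → ⊥) k done Q (dist x)
    step : ∀ {done w us flags x} → Inv done (queue (w ∷ us) flags , x) →
           Triple (forEach (lookup Γ w) (visit w) (queue us (flags [ w ]≔ false) , x))
                  (suc (suc c * length (lookup Γ w))) (Inv (done ∷ʳ w))
    step {done} {w} {x = x} (_ , B) =
      post-map (λ S → lookup (dist x) w , scanned Γ S)
        (forEach-rule (lookup Γ w)
          (λ us (Q , x′) → Scanning Γ w (lookup (dist x) w) (done ∷ʳ w) us Q (dist x′))
          visit-rule (bfs-pop Γ B))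

  -- The individual searches.

  accumulate-rule : ∀ w u (σ : Vec ℕ n) → Triple (accumulate w u σ) 4 (λ _ → ⊤)
  accumulate-rule w u σ = charged charged charged charge-rule _

  visit₁-rule : ∀ {Γ w k done u us Q d} → Scanning Γ w k done (u ∷ us) Q d →
                Triple (visit₁ w u (Q , d)) 15 (λ (Q′ , d′) → Scanning Γ w k done us Q′ d′)
  -- Padded to the cost of `visit₂`, which is 8 for `discover`, 3 for `closer` and 4 for
  -- `accumulate`, so that all searches pay 16 per arc.
  visit₁-rule {Γ} S = weaken (ℕ.m≤m+n 8 7) (discover-rule Γ S)

  visit₂-rule : ∀ dₛ {Γ w k done u us Q x} → Scanning Γ w k done (u ∷ us) Q (proj₁ x) →
                Triple (visit₂ dₛ w u (Q , x)) 15
                  (λ (Q′ , x′) → Scanning Γ w k done us Q′ (proj₁ x′))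
  visit₂-rule dₛ {Γ} {w} {u = u} {x = d , σ} S =
    >>=-rule (discover-rule Γ S) λ S′ →
      >>=-rule {i = 3} {R = λ b → b ≡ does (lookup dₛ u ℤ.<? lookup dₛ w)}
        (charged charged charge-rule refl) λ where
        refl → branch (lookup dₛ u ℤ.<? lookup dₛ w)
          (λ _ → >>=-rule (accumulate-rule w u σ) (λ _ → charge-rule S′))
          (λ _ → weaken z≤n (charge-rule S′))

  -- The key is - d.  An arc w → u that is followed has e u = e w + 1, whereas every
  -- vertex that has left the queue has a key of at most e w.
  search₃-rule : ∀ d {arcs Γ r Q σ} → Network arcs Γ → Layered Γ d → Idle Q →
    Triple (search Γ (visit₃ d) r (Q , σ)) (4 * n + 16 * length arcs + 4) (λ _ → ⊤)
  search₃-rule d {Γ = Γ} {r} N layered idle =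
    post-map (λ _ → _)
      (search-rule {visit = visit₃ d} {c = 15} N Inv (λ (_ , F) → Frontier.distinct F) step
        (post-map (λ (F , _) → ℤ.- lookup d r ℤ.- 1ℤ , F)
          (enqueue-rule (idle⇒frontier idle) (λ ()) start)))
    where
    e : V → ℤ
    e v = ℤ.- lookup d v
    Inv : List V → Queue n × Vec ℕ n → Set
    Inv done (Q , _) = ∃[ k ] Frontier e k done Q
    -- The initial `k` is one below the key of the root, which thus enters at `k + 1`.
    start : e r ≡ e r ℤ.- 1ℤ ℤ.+ 1ℤ
    start = sym (trans (ℤ.+-assoc (e r) -1ℤ 1ℤ) (ℤ.+-identityʳ (e r)))
    step : ∀ {done w us flags σ} → Inv done (queue (w ∷ us) flags , σ) →
           Triple (forEach (lookup Γ w) (visit₃ d w) (queue us (flags [ w ]≔ false) , σ))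
                  (suc (16 * length (lookup Γ w))) (Inv (done ∷ʳ w))
    step {done} {w} (_ , F) =
      post-map (λ (F′ , _) → e w , F′) (forEach-rule (lookup Γ w) J visit₃-rule (frontier-pop F , id))
      where
      J : List V → Queue n × Vec ℕ n → Set
      J us (Q , _) = Frontier e (e w) (done ∷ʳ w) Q × (∀ {u} → u ∈ us → u ∈ lookup Γ w)
      visit₃-rule : ∀ {u us s} → J (u ∷ us) s → Triple (visit₃ d w u s) 15 (J us)
      visit₃-rule {u} {us} {Q , σ} (F′ , us⊆) = weaken (ℕ.m≤m+n 10 5)
        (>>=-rule {i = 3} {R = λ b → b ≡ does (lookup d u ℤ.<? lookup d w)}
          (charged charged charge-rule refl) λ where
          refl → branch (lookup d u ℤ.<? lookup d w)
            (λ dᵤ<d →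
              let eᵤ = neg-flip-+1 (layered (us⊆ (here refl)) dᵤ<d)
                  u∉ = λ u∈ → ℤ.≤⇒≯ (Frontier.behind F′ u∈) (subst (e w ℤ.<_) (sym eᵤ) i<i+1)
              in >>=-rule (enqueue-rule F′ u∉ eᵤ) λ (F″ , _) →
                 >>=-rule (accumulate-rule w u σ) λ _ → charge-rule (F″ , us⊆ ∘ there))
            (λ _ → weaken z≤n (charge-rule (F′ , us⊆ ∘ there))))

  -- One iteration over an edge.

  score-rule : ∀ (e : V × V) σₛ σₜ w C → Triple (score e σₛ σₜ w C) 10 (λ _ → ⊤)
  score-rule (s , t) σₛ σₜ w C =
    charged charged branch (T? (does (w ≟ s) ∨ does (w ≟ t)))
      (λ _ → weaken z≤n (charge-rule _))
      (λ _ → charged charged charged charged charged charged charged charge-rule _)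

  -- Each search hands an idle queue to the next, and the second hands its layers to the third. The
  -- 33 is 5 for the edge removal, 5 for four arrays and the queue flags, 12 for the searches and 11
  -- for the scores; 48 is three times 16.
  processEdge-rule : ∀ {arcs : List (V × V)} {Γ} → Network arcs Γ → ∀ e C →
    Triple (processEdge Γ e C) (33 * n + 48 * length arcs + 23) (λ _ → ⊤)
  processEdge-rule {arcs} N (s , t) C =
    weaken (≤-reflexive (arith n (length arcs)))
    (>>=-rule (∖-rule s t N) λ N′ →
     charged charged charged charged charged charged charged charged
     >>=-rule {i = n} {R = Idle}
       (weaken (≤-reflexive (ℕ.+-identityʳ n))
         (charged charge-rule (refl , λ u → subst (¬_ ∘ T) (sym (lookup-replicate u false)) id)))
       λ idle →
     >>=-rule (bfs-rule id N′ visit₁-rule idle (root s) (away s))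
       λ { {_ , dₛ} (idle , _) →
     >>=-rule (bfs-rule proj₁ N′ (visit₂-rule dₛ) idle (root t) (away t))
       λ { {_ , dₜ , σₜ} (idle , layered) →
     >>=-rule (search₃-rule dₜ N′ layered idle) λ { {_ , σₛ} _ →
     weaken (≤-reflexive (cong (λ l → suc (11 * l)) (length-tabulate {n = n} id)))
       (forEach-rule (allFin n) (λ _ _ → ⊤) (λ _ → score-rule (s , t) σₛ σₜ _ _) _) }}})
    where
    root : ∀ r → lookup (replicate n -1ℤ [ r ]≔ 0ℤ) r ≡ 0ℤ
    root r = lookup∘update r (replicate n -1ℤ) 0ℤ
    away : ∀ r {u} → u ≢ r → lookup (replicate n -1ℤ [ r ]≔ 0ℤ) u ≡ -1ℤ
    away r {u} u≢r =
      trans (lookup∘update′ u≢r (replicate n -1ℤ) 0ℤ) (lookup-replicate u -1ℤ)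
    arith : ∀ n a →
      5 * n + 6 + (n + (n + (1 + (1 + (n + (n + (1 + (1 + (n +
      (4 * n + 16 * a + 4 + (4 * n + 16 * a + 4 + (4 * n + 16 * a + 4 + suc (11 * n)))))))))))))
      ≡ 33 * n + 48 * a + 23
    arith = solve-∀

-- The whole algorithm, with two arcs per edge.

module _ (G : Graph) (A : AdjacencyLists G) where

  open Graph G hiding (n; m)
  open AdjacencyLists A

  network : Network (E ++ map swap E) Γ
  network = record
    { unique    = unique
    ; sound     = λ {u} {v} u∈ →
        [ ∈-++⁺ˡ , ∈-++⁺ʳ E ∘ ∈-map⁺ swap ]′ (Equivalence.to (adjacent u v) u∈)
    ; symmetric = λ {u} {v} u∈ →
        Equivalence.from (adjacent v u) (Sum.swap (Equivalence.to (adjacent u v) u∈))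
    }

  pathCore-rule : Triple (pathCore G A) (n G + suc ((33 * n G + 96 * m G + 24) * m G))
                    (λ _ → ⊤)
  pathCore-rule = charged weaken (≤-reflexive count)
    (forEach-rule E (λ _ _ → ⊤) (λ _ → processEdge-rule network _ _) _)
    where
    arcs : length (E ++ map swap E) ≡ m G + m G
    arcs = trans (length-++ E) (cong (m G +_) (length-map swap E))
    arith : ∀ n m → suc (suc (33 * n + 48 * (m + m) + 23) * m) ≡
                    suc ((33 * n + 96 * m + 24) * m)
    arith = solve-∀
    count : suc (suc (33 * n G + 48 * length (E ++ map swap E) + 23) * m G) ≡
            suc ((33 * n G + 96 * m G + 24) * m G)
    count = trans (cong (λ a → suc (suc (33 * n G + 48 * a + 23) * m G)) arcs)
                  (arith (n G) (m G))

lemma2 : (K : ℕ) →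
    ∃[ c ] ∃[ m₀ ]
    ((G : Graph) (A : AdjacencyLists G) →
    m₀ ≤ m G →
    n G ≤ K * m G →
    pathCore G A finishesWithin (c * m G ^ 2))
-- 34 is 33 for the iterations and 1 for the array `C`; 121 is 96 + 24 + 1, where `1 ≤ m` raises the
-- lower-order terms to multiples of `m * m`.
lemma2 K = 34 * K + 121 , 1 , λ G A 1≤m n≤Km →
  let halts run _ bound = pathCore-rule G A
  in _ , _ , run , ≤-trans bound (estimate (n G) (m G) 1≤m n≤Km)
  where
  open ≤-Reasoning
  estimate : ∀ n m → 1 ≤ m → n ≤ K * m →
             n + suc ((33 * n + 96 * m + 24) * m) ≤ (34 * K + 121) * m ^ 2
  estimate n m@(suc _) 1≤m n≤Km = begin
    n + suc ((33 * n + 96 * m + 24) * m)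
      ≤⟨ ℕ.+-mono-≤ (ℕ.m≤m*n n m)
           (ℕ.+-mono-≤ (ℕ.*-mono-≤ 1≤m 1≤m)
             (ℕ.*-monoˡ-≤ m (ℕ.+-monoʳ-≤ (33 * n + 96 * m) (ℕ.*-monoʳ-≤ 24 1≤m)))) ⟩
    n * m + (m * m + (33 * n + 96 * m + 24 * m) * m)
      ≡⟨ collect n m ⟩
    34 * (n * m) + 121 * m ^ 2
      ≤⟨ ℕ.+-monoˡ-≤ (121 * m ^ 2) (ℕ.*-monoʳ-≤ 34 (ℕ.*-monoˡ-≤ m n≤Km)) ⟩
    34 * (K * m * m) + 121 * m ^ 2
      ≡⟨ factor K m ⟩
    (34 * K + 121) * m ^ 2 ∎
    where
    -- m * (m * 1) is m ^ 2 unfolded.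
    collect : ∀ n m → n * m + (m * m + (33 * n + 96 * m + 24 * m) * m) ≡
                      34 * (n * m) + 121 * (m * (m * 1))
    collect = solve-∀
    factor : ∀ K m → 34 * (K * m * m) + 121 * (m * (m * 1)) ≡ (34 * K + 121) * (m * (m * 1))
    factor = solve-∀
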